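{- $R(Q_2, Q_3) = 5$.
   Context: $Q_k$ denotes the Boolean lattice of dimension $k$: the family of all subsets of a $k$-element ground set (e.g. $[k]=\{1,\dots,k\}$), ordered by inclusion. A subposet $Q'$ of a poset $Q$ is a copy of a poset $P$ if there is a bijection $f$ from $P$ to $Q'$ such that $x \le y$ in $P$ if and only if $f(x) \le f(y)$ in $Q$. For posets $P, P'$, the poset Ramsey number $R(P,P')$ is the smallest integer $N$ such that for every coloring of the elements of $Q_N$ in red and blue, there is a copy of $P$ all of whose elements are red or a copy of $P'$ all of whose elements are blue. -}

module Defs where

open import Data.Nat using (ℕ; _<_)
open import Data.Bool using (Bool; true; false)
open import Data.Fin.Subset using (Subset; _⊆_)
open import Data.Product using (Σ; _×_; ∃)
open import Data.Sum using (_⊎_)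
open import Relation.Binary.PropositionalEquality using (_≡_)
open import Relation.Nullary using (¬_)
open import Function.Bundles using (_⇔_)
open import Function.Definitions using (Injective)

Q : ℕ → Set
Q k = Subset k

IsCopy : (k n : ℕ) → (Q k → Q n) → Set
IsCopy k n f = Injective _≡_ _≡_ f × (∀ x y → (x ⊆ y) ⇔ (f x ⊆ f y))

-- A 2-colouring of Q_N: true = red, false = blue.
Coloring : ℕ → Set
Coloring N = Q N → Bool

MonoCopy : (k N : ℕ) → Coloring N → Bool → Set
MonoCopy k N c b = Σ (Q k → Q N) λ f → IsCopy k N f × (∀ x → c (f x) ≡ b)

Arrows : (k l N : ℕ) → Set
Arrows k l N = (c : Coloring N) → MonoCopy k N c true ⊎ MonoCopy l N c false

IsRamseyNumber : (k l N : ℕ) → Set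
IsRamseyNumber k l N = Arrows k l N × (∀ M → M < N → ¬ Arrows k l M)

{-# OPTIONS --safe #-}
-- Upper bound: a colouring of Q₅ with neither copy would satisfy the constraints "not all of R
-- is red" for every copy R of Q₂ and "not all of B is blue" for every copy B of Q₃.  A
-- backtracking search with unit propagation, proved sound and run by the type checker, shows
-- that these constraints are contradictory.  The copies are presented coordinatewise: n monotone
-- Boolean functions on Q_k form an order-preserving map Q_k → Q_n, which is an order embedding
-- as soon as every coordinate projection of Q_k occurs among them.
-- Lower bound: colour the sets of size at most 1 red.  Along a copy of Q_k the size grows by at
-- least k from bottom to top, so a red Q₂ or, in dimension at most 4, a blue Q₃ does not fit.

module Submission where

open import Defs
open import Data.Bool as Bool using (Bool; true; false; _∧_; _xor_; not; T; if_then_else_)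
open import Data.Bool.ListAction using (all; any)
import Data.Bool.Properties as Bool
open import Data.Fin as Fin using ()
open import Data.Fin.Subset using (Subset; _⊆_; _⊂_; ∣_∣; ⊥; ⊤; outside; inside)
open import Data.Fin.Subset.Properties
  using (_⊆?_; ⊆-refl; ⊆-reflexive; ⊆-antisym; s⊆s; s⊂s; out⊆; out⊂in;
         drop-∷-⊆; ⊂-irref; p⊂q⇒∣p∣<∣q∣; ∣p∣≤n)
open import Data.List as List
  using (List; []; _∷_; _++_; filter; filterᵇ; length; null; cartesianProductWith; allFin)
open import Data.List.Membership.Propositional using () renaming (_∈_ to _∈ᴸ_)
open import Data.List.Membership.Propositional.Properties
  using (∈-map⁺; ∈-++⁺ˡ; ∈-++⁺ʳ; ∈-allFin)
open import Data.List.Relation.Unary.All as All using (All; []; _∷_)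
import Data.List.Relation.Unary.All.Properties as All
open import Data.List.Relation.Unary.Any using (here)
open import Data.Nat using (ℕ; zero; suc; _+_; _*_; _≤_; _<_; _≡ᵇ_; _<ᵇ_; _/_; _%_)
open import Data.Nat.Properties
  using (≡ᵇ⇒≡; <ᵇ⇒<; <⇒<ᵇ; ≤-reflexive; module ≤-Reasoning;
         +-monoˡ-≤; +-suc; +-identityʳ; m+n≤o⇒n≤o; <⇒≱; ≮⇒≥)
open import Data.Product using (_×_; _,_; proj₁; proj₂)
open import Data.Sum as Sum using (_⊎_; inj₁; inj₂)
open import Data.Unit using (tt)
open import Data.Vec as Vec using (Vec; []; _∷_; lookup; here)
open import Data.Vec.Membership.Propositional using () renaming (_∈_ to _∈ⱽ_)
open import Data.Vec.Properties using (≡-dec)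
open import Data.Vec.Relation.Unary.All as AllV using ([]; _∷_)
open import Data.Vec.Relation.Unary.Any using (here; there)
open import Function using (_∘_; _$_; Equivalence; mk⇔)
open import Relation.Binary.PropositionalEquality
  using (_≡_; refl; sym; trans; cong; subst; setoid)
open import Relation.Nullary using (¬_; Dec; contradiction; _→-dec_)
open import Relation.Nullary.Decidable using (map′; toWitness)
open import Relation.Unary using (Decidable)

-- Refuting systems of colouring constraints

-- A constraint is the list of its still uncoloured elements, encoded as numbers because the
-- type checker compares literals in one step.
Clause : Set
Clause = List ℕ

-- Removes only the first occurrence, which suffices for soundness.
without : ℕ → Clause → Clause
without x []      = []
without x (y ∷ K) = if x ≡ᵇ y then K else y ∷ without x K

contains : ℕ → Clause → Bool
contains x []      = false
contains x (y ∷ K) = if x ≡ᵇ y then true else contains x K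

avoiding : ℕ → List Clause → List Clause
avoiding x = filterᵇ (λ K → not (contains x K))

shorter : Clause → Clause → Bool
shorter []      _       = true
shorter (_ ∷ _) []      = false
shorter (_ ∷ K) (_ ∷ L) = shorter K L

-- A shortest constraint decides the next move of the search: if empty it is violated, if a
-- singleton it forces a colour, and only when neither colour offers such a constraint does the
-- search split.
shortest : Clause → List Clause → Clause
shortest K  []       = K
shortest [] _        = []
shortest K  (L ∷ Ls) = if shorter K L then shortest K Ls else shortest L Ls

-- The first argument bounds the depth of the search.
refutes : ℕ → List Clause → List Clause → Bool
branch  : ℕ → List Clause → List Clause → Clause → Clause → Bool
red blue : ℕ → List Clause → List Clause → ℕ → Bool

refutes n (R ∷ Rs) (B ∷ Bs) = branch n (R ∷ Rs) (B ∷ Bs) (shortest R Rs) (shortest B Bs)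
-- With one kind of constraint left, giving all remaining elements the other colour satisfies
-- everything except an empty constraint.
refutes n (R ∷ Rs) []       = null (shortest R Rs)
refutes n []       (B ∷ Bs) = null (shortest B Bs)
refutes n []       []       = false

branch zero    Rs Bs _           _           = false
branch (suc n) Rs Bs []          _           = true
branch (suc n) Rs Bs (x ∷ [])    _           = blue n Rs Bs x
branch (suc n) Rs Bs (_ ∷ _ ∷ _) []          = true
branch (suc n) Rs Bs (_ ∷ _ ∷ _) (x ∷ [])    = red n Rs Bs x
branch (suc n) Rs Bs (_ ∷ _ ∷ _) (x ∷ _ ∷ _) = red n Rs Bs x ∧ blue n Rs Bs x

-- A red `x` shrinks the red constraints through it and settles the blue ones.
red  n Rs Bs x = refutes n (List.map (without x) Rs) (avoiding x Bs)
blue n Rs Bs x = refutes n (avoiding x Rs) (List.map (without x) Bs)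

shortest-preserves : ∀ {P : Clause → Set} K Ks → P K → All P Ks → P (shortest K Ks)
shortest-preserves K       []       p _        = p
shortest-preserves []      (_ ∷ _)  p _        = p
shortest-preserves (x ∷ K) (L ∷ Ls) p (q ∷ qs) with shorter (x ∷ K) L
... | true  = shortest-preserves (x ∷ K) Ls p qs
... | false = shortest-preserves L Ls q qs

-- Violating the constraint yields `A` instead of absurdity, so a refutation produces an actual
-- copy.
Forces : (ℕ → Bool) → Bool → Set → Clause → Set
Forces c b A K = All (λ x → c x ≡ b) K → A

module _ {c : ℕ → Bool} where

  without-forces : ∀ {b A x K} → c x ≡ b → Forces c b A K → Forces c b A (without x K)
  without-forces {b} {x = x} cx f = f ∘ restore _
    where
    restore : ∀ K → All (λ y → c y ≡ b) (without x K) → All (λ y → c y ≡ b) K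
    restore []      _  = []
    restore (y ∷ K) cs with x ≡ᵇ y in eq | cs
    ... | true  | cK      = subst (λ z → c z ≡ b) (≡ᵇ⇒≡ x y (subst T (sym eq) tt)) cx ∷ cK
    ... | false | cy ∷ cK = cy ∷ restore K cK

  null-forces : ∀ {b A} K → Forces c b A K → T (null K) → A
  null-forces [] f _ = f []

module _ {c : ℕ → Bool} {P Q : Set} where

  -- The colouring `c` selects one path through the search tree; it ends at a constraint that `c`
  -- violates, and this yields `P` or `Q`.
  refutes-sound : ∀ n {Rs Bs} → All (Forces c true P) Rs → All (Forces c false Q) Bs →
                  T (refutes n Rs Bs) → P ⊎ Q
  branch-sound  : ∀ n {Rs Bs} R B → All (Forces c true P) Rs → All (Forces c false Q) Bs →
                  Forces c true P R → Forces c false Q B → T (branch n Rs Bs R B) → P ⊎ Q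
  red-sound     : ∀ n {Rs Bs} x → All (Forces c true P) Rs → All (Forces c false Q) Bs →
                  c x ≡ true → T (red n Rs Bs x) → P ⊎ Q
  blue-sound    : ∀ n {Rs Bs} x → All (Forces c true P) Rs → All (Forces c false Q) Bs →
                  c x ≡ false → T (blue n Rs Bs x) → P ⊎ Q

  refutes-sound n {R ∷ Rs} {B ∷ Bs} (r ∷ rs) (b ∷ bs) =
    branch-sound n (shortest R Rs) (shortest B Bs) (r ∷ rs) (b ∷ bs)
      (shortest-preserves R Rs r rs) (shortest-preserves B Bs b bs)
  refutes-sound n {R ∷ Rs} (r ∷ rs) [] =
    inj₁ ∘ null-forces (shortest R Rs) (shortest-preserves R Rs r rs)
  refutes-sound n {Bs = B ∷ Bs} [] (b ∷ bs) =
    inj₂ ∘ null-forces (shortest B Bs) (shortest-preserves B Bs b bs)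

  branch-sound (suc n) []       _ rs bs r b t = inj₁ (r [])
  branch-sound (suc n) (x ∷ []) _ rs bs r b t with c x in cx
  ... | true  = inj₁ (r (cx ∷ []))
  ... | false = blue-sound n x rs bs cx t
  branch-sound (suc n) (_ ∷ _ ∷ _) []          rs bs r b t = inj₂ (b [])
  branch-sound (suc n) (_ ∷ _ ∷ _) (x ∷ [])    rs bs r b t with c x in cx
  ... | true  = red-sound n x rs bs cx t
  ... | false = inj₂ (b (cx ∷ []))
  branch-sound (suc n) (_ ∷ _ ∷ _) (x ∷ _ ∷ _) rs bs r b t with c x in cx
  ... | true  = red-sound n x rs bs cx (proj₁ (Equivalence.to Bool.T-∧ t))
  ... | false = blue-sound n x rs bs cx (proj₂ (Equivalence.to Bool.T-∧ t))

  red-sound n x rs bs cx =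
    refutes-sound n (All.map⁺ (All.map (without-forces cx) rs)) (All.filter⁺ _ bs)
  blue-sound n x rs bs cx =
    refutes-sound n (All.filter⁺ _ rs) (All.map⁺ (All.map (without-forces cx) bs))

-- A data type, so that conversion checking never unfolds the search again; 33 = 2⁵ + 1 suffices
-- because every level of the search colours a further element.
data Refuted (Rs Bs : List Clause) : Set where
  refuted : refutes 33 Rs Bs ≡ true → Refuted Rs Bs

refuted-sound : ∀ {c P Q Rs Bs} → All (Forces c true P) Rs → All (Forces c false Q) Bs →
                Refuted Rs Bs → P ⊎ Q
refuted-sound rs bs (refuted t) = refutes-sound 33 rs bs (Equivalence.from Bool.T-≡ t)

-- Enumeration of subsets and monotone Boolean functions

subsets : ∀ k → List (Subset k)
subsets zero    = [] ∷ []
subsets (suc k) = List.map (outside ∷_) (subsets k) ++ List.map (inside ∷_) (subsets k)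

∈-subsets : ∀ {k} (p : Subset k) → p ∈ᴸ subsets k
∈-subsets []            = here refl
∈-subsets (outside ∷ p) = ∈-++⁺ˡ (∈-map⁺ (outside ∷_) (∈-subsets p))
∈-subsets (inside ∷ p)  = ∈-++⁺ʳ _ (∈-map⁺ (inside ∷_) (∈-subsets p))

allSubsets? : ∀ {k} {P : Subset k → Set} → Decidable P → Dec (∀ p → P p)
allSubsets? {k} P? = map′
  (λ Ps p → All.lookup Ps (∈-subsets p)) (λ Ps → All.tabulate (λ {p} _ → Ps p))
  (All.all? P? (subsets k))

BooleanFunction : ℕ → Set
BooleanFunction k = Subset k → Bool

booleanFunctions : ∀ k → List (BooleanFunction k)
booleanFunctions zero    = (λ _ → false) ∷ (λ _ → true) ∷ []
booleanFunctions (suc k) = cartesianProductWith (λ { f g (s ∷ p) → if s then g p else f p })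
  (booleanFunctions k) (booleanFunctions k)

Monotone : ∀ {k} → BooleanFunction k → Set
Monotone φ = ∀ p q → p ⊆ q → φ p Bool.≤ φ q

monotone? : ∀ {k} → Decidable (Monotone {k})
monotone? φ = allSubsets? λ p → allSubsets? λ q → (p ⊆? q) →-dec (φ p Bool.≤? φ q)

projections : ∀ k → List (BooleanFunction k)
projections k = List.map (λ i p → lookup p i) (allFin k)

-- Functions are compared pointwise. Of the 6 and 20 monotone functions (Dedekind numbers) for `k` =
-- 2 and 3, this leaves 4 and 17.
nonProjections : ∀ k → List (BooleanFunction k)
nonProjections k = filterᵇ
  (λ φ → all (λ π → any (λ p → φ p xor π p) (subsets k)) (projections k))
  (filter monotone? (booleanFunctions k))

-- Order embeddings given coordinatewise

head-mono : ∀ {n s t} {p q : Subset n} → s ∷ p ⊆ t ∷ q → s Bool.≤ t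
head-mono {s = false} {t} _ = Bool.≤-minimum t
head-mono {s = true} p⊆q with here ← p⊆q here = Bool.b≤b

∷-mono : ∀ {n s t} {p q : Subset n} → s Bool.≤ t → p ⊆ q → s ∷ p ⊆ t ∷ q
∷-mono Bool.f≤t = out⊆
∷-mono Bool.b≤b = s⊆s

lookup-mono : ∀ {n} {p q : Subset n} i → p ⊆ q → lookup p i Bool.≤ lookup q i
lookup-mono {p = _ ∷ _} {_ ∷ _} Fin.zero    p⊆q = head-mono p⊆q
lookup-mono {p = _ ∷ _} {_ ∷ _} (Fin.suc i) p⊆q = lookup-mono i (drop-∷-⊆ p⊆q)

lookup-cancel : ∀ {n} (p q : Subset n) → (∀ i → lookup p i Bool.≤ lookup q i) → p ⊆ q
lookup-cancel []      []      _  = λ ()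
lookup-cancel (_ ∷ p) (_ ∷ q) le = ∷-mono (le Fin.zero) (lookup-cancel p q (le ∘ Fin.suc))

image : ∀ {k n} → Vec (BooleanFunction k) n → Subset k → Subset n
image φs p = Vec.map (_$ p) φs

image-mono : ∀ {k n} {φs : Vec (BooleanFunction k) n} {p q} →
             AllV.All Monotone φs → p ⊆ q → image φs p ⊆ image φs q
image-mono []       p⊆q = λ ()
image-mono (m ∷ ms) p⊆q = ∷-mono (m _ _ p⊆q) (image-mono ms p⊆q)

image-reflects : ∀ {k n φ} {φs : Vec (BooleanFunction k) n} {p q} →
                 φ ∈ⱽ φs → image φs p ⊆ image φs q → φ p Bool.≤ φ q
image-reflects (here refl) p⊆q = head-mono p⊆q
image-reflects (there φ∈)  p⊆q = image-reflects φ∈ (drop-∷-⊆ p⊆q)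

-- The list `πs` is arbitrary because the tail of a word only has to cover the projections that have
-- not yet occurred.
Embedding : ∀ {k n} → List (BooleanFunction k) → Vec (BooleanFunction k) n → Set
Embedding πs φs = AllV.All Monotone φs × All (_∈ⱽ φs) πs

embedding-isCopy : ∀ {k n} {φs : Vec (BooleanFunction k) n} →
                   Embedding (projections k) φs → IsCopy k n (image φs)
embedding-isCopy {φs = φs} (monotone , covers) =
  (λ eq → ⊆-antisym (reflects (⊆-reflexive eq)) (reflects (⊆-reflexive (sym eq)))) ,
  λ p q → mk⇔ (image-mono monotone) reflects
  where
  reflects : ∀ {p q} → image φs p ⊆ image φs q → p ⊆ q
  reflects {p} {q} le = lookup-cancel p q λ i →
    image-reflects (All.lookup covers (∈-map⁺ _ (∈-allFin i))) le

-- The words of length n over φs and πs in which the letters πs first occur in this order, each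
-- being available for reuse only after its first occurrence.  Starting from the monotone
-- non-projections this lists every copy once up to automorphisms of Q_k.
embeddings : ∀ {k} → List (BooleanFunction k) → List (BooleanFunction k) → ∀ n →
             List (Vec (BooleanFunction k) n)
embeddings φs []       zero    = [] ∷ []
embeddings φs (_ ∷ _)  zero    = []
embeddings φs []       (suc n) = cartesianProductWith _∷_ φs (embeddings φs [] n)
embeddings φs (π ∷ πs) (suc n) =
  List.map (π ∷_) (embeddings (φs ++ π ∷ []) πs n) ++
  -- After a letter from `φs`, the `n` remaining places must still hold `π` and all of `πs`.
  (if length πs <ᵇ n then cartesianProductWith _∷_ φs (embeddings φs (π ∷ πs) n) else [])

extend : ∀ {k n φ} {φs : Vec (BooleanFunction k) n} {πs} →
         Monotone φ → Embedding πs φs → Embedding πs (φ ∷ φs)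
extend m (ms , cs) = m ∷ ms , All.map there cs

extendAll : ∀ {k n φs πs} {ψss : List (Vec (BooleanFunction k) n)} →
            All Monotone φs → All (Embedding πs) ψss →
            All (Embedding πs) (cartesianProductWith _∷_ φs ψss)
extendAll ms es = All.cartesianProductWith⁺ (setoid _) (setoid _) _∷_ _ _
  λ φ∈ ψ∈ → extend (All.lookup ms φ∈) (All.lookup es ψ∈)

embeddings-valid : ∀ {k} {φs πs : List (BooleanFunction k)} → All Monotone φs → All Monotone πs →
                   ∀ n → All (Embedding πs) (embeddings φs πs n)
embeddings-valid φm []       zero    = ([] , []) ∷ []
embeddings-valid φm (_ ∷ _)  zero    = []
embeddings-valid φm []       (suc n) = extendAll φm (embeddings-valid φm [] n)
embeddings-valid {πs = π ∷ πs} φm (m ∷ ms) (suc n) = All.++⁺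
  (All.map⁺ (All.map (λ { (φm′ , cs) → m ∷ φm′ , here refl ∷ All.map there cs })
    (embeddings-valid (All.++⁺ φm (m ∷ [])) ms n)))
  free
  where
  free : All _ (if length πs <ᵇ n then _ else [])
  free with length πs <ᵇ n
  ... | true  = extendAll φm (embeddings-valid φm (m ∷ ms) n)
  ... | false = []

-- The upper bound

code : ∀ {n} → Subset n → ℕ
code []      = 0
code (s ∷ p) = (if s then 1 else 0) + 2 * code p

decode : ∀ n → ℕ → Subset n
decode zero    m = []
decode (suc n) m = (m % 2 ≡ᵇ 1) ∷ decode n (m / 2)

-- Evaluated on all 32 subsets. It lets a colouring of `Q 5` be read off from the codes.
decode-code : (p : Subset 5) → decode 5 (code p) ≡ p
decode-code = toWitness {a? = allSubsets? λ p → ≡-dec Bool._≟_ (decode 5 (code p)) p} tt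

copies : ∀ k n → List (Vec (BooleanFunction k) n)
copies k = embeddings (nonProjections k) (projections k)

copies-valid : ∀ k n → All (Embedding (projections k)) (copies k n)
copies-valid k = embeddings-valid
  (All.filter⁺ _ (All.all-filter monotone? (booleanFunctions k)))
  (All.map⁺ (All.universal (λ i p q → lookup-mono i) (allFin k)))

clause : ∀ {k n} → Vec (BooleanFunction k) n → Clause
clause {k} φs = List.map (code ∘ image φs) (subsets k)

clauses : ℕ → List Clause
clauses k = List.map clause (copies k 5)

pullback : Coloring 5 → ℕ → Bool
pullback c m = c (decode 5 m)

clauses-force : ∀ k c b →
                All (Forces (pullback c) b (MonoCopy k 5 c b)) (clauses k)
clauses-force k c b = All.map⁺ (All.map force (copies-valid k 5))
  where
  force : ∀ {φs} → Embedding (projections k) φs → _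
  force {φs} e cs = image φs , embedding-isCopy e , λ p →
    trans (cong c (sym (decode-code (image φs p)))) (All.lookup (All.map⁻ cs) (∈-subsets p))

search-succeeds : Refuted (clauses 2) (clauses 3)
-- Checking this `refl` runs the whole search.
search-succeeds = refuted refl

arrows : Arrows 2 3 5
arrows c = refuted-sound (clauses-force 2 c true) (clauses-force 3 c false) search-succeeds

-- The lower bound

⊆⇒≡⊎⊂ : ∀ {n} (p q : Subset n) → p ⊆ q → p ≡ q ⊎ p ⊂ q
⊆⇒≡⊎⊂ []            []            _   = inj₁ refl
⊆⇒≡⊎⊂ (outside ∷ p) (inside ∷ q)  p⊆q = inj₂ (out⊂in (drop-∷-⊆ p⊆q))
⊆⇒≡⊎⊂ (inside ∷ p)  (outside ∷ q) p⊆q = contradiction (p⊆q here) λ ()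
⊆⇒≡⊎⊂ (outside ∷ p) (outside ∷ q) p⊆q = Sum.map (cong (outside ∷_)) s⊂s (⊆⇒≡⊎⊂ p q (drop-∷-⊆ p⊆q))
⊆⇒≡⊎⊂ (inside ∷ p)  (inside ∷ q)  p⊆q = Sum.map (cong (inside ∷_)) s⊂s (⊆⇒≡⊎⊂ p q (drop-∷-⊆ p⊆q))

isCopy-∣∣-strictMono : ∀ {k n f} → IsCopy k n f → ∀ {p q} → p ⊂ q → ∣ f p ∣ < ∣ f q ∣
isCopy-∣∣-strictMono {f = f} (injective , order) {p} {q} p⊂q
  with ⊆⇒≡⊎⊂ (f p) (f q) (Equivalence.to (order p q) (proj₁ p⊂q))
... | inj₁ fp≡fq = contradiction p⊂q (⊂-irref (injective fp≡fq))
... | inj₂ fp⊂fq = p⊂q⇒∣p∣<∣q∣ fp⊂fq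

-- Climb a maximal chain: inserting the first element gains at least 1, and the sets containing it
-- form a lattice of dimension one less.
strictMono-growth : ∀ k (g : Subset k → ℕ) → (∀ {p q} → p ⊂ q → g p < g q) → g ⊥ + k ≤ g ⊤
strictMono-growth zero    g mono = ≤-reflexive (+-identityʳ (g []))
strictMono-growth (suc k) g mono = begin
  g ⊥ + suc k        ≡⟨ +-suc (g ⊥) k ⟩
  suc (g ⊥) + k      ≤⟨ +-monoˡ-≤ k (mono (out⊂in ⊆-refl)) ⟩
  g (inside ∷ ⊥) + k ≤⟨ strictMono-growth k (g ∘ (inside ∷_)) (mono ∘ s⊂s) ⟩
  g ⊤                ∎
  where open ≤-Reasoning

isCopy-height : ∀ {k n f} → IsCopy k n f → ∣ f ⊥ ∣ + k ≤ ∣ f ⊤ ∣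
isCopy-height {k} {f = f} copy = strictMono-growth k (∣_∣ ∘ f) (isCopy-∣∣-strictMono copy)

¬arrows : ∀ M → M < 5 → ¬ Arrows 2 3 M
-- One threshold serves every `M` below 5: a red copy would need a top of size at least 2, and a
-- blue one a top of size at least 2 + 3.
¬arrows M M<5 arrow with arrow (λ p → ∣ p ∣ <ᵇ 2)
... | inj₁ (f , copy , low) =
  <⇒≱ (<ᵇ⇒< _ 2 (subst T (sym (low ⊤)) tt)) (m+n≤o⇒n≤o ∣ f ⊥ ∣ (isCopy-height copy))
... | inj₂ (f , copy , high) = <⇒≱ M<5 (begin
  2 + 3         ≤⟨ +-monoˡ-≤ 3 (≮⇒≥ λ lt → subst T (high ⊥) (<⇒<ᵇ {n = 2} lt)) ⟩
  ∣ f ⊥ ∣ + 3   ≤⟨ isCopy-height copy ⟩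
  ∣ f ⊤ ∣       ≤⟨ ∣p∣≤n (f ⊤) ⟩
  M             ∎)
  where open ≤-Reasoning

theorem8 : IsRamseyNumber 2 3 5
theorem8 = arrows , ¬arrows
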